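{- Let $(X,S)$ be an association scheme, $T$ a closed subset of $S$, and $X_1, X_2, \dots, X_m$ the cosets of $T$ in $X$. Suppose that $\iota_1, \iota_2, \dots, \iota_m \in \mathrm{Aut}(T)$ extend to $\tilde{\iota}_1, \tilde{\iota}_2, \dots, \tilde{\iota}_m \in \mathrm{Aut}(S)$ by $s^{\tilde{\iota}_j} = s$ if $s \in S \setminus T$ and $s^{\tilde{\iota}_j}= s^{\iota_j}$ if $s \in T$, for all $j=1, \dots, m$ (that is, each map $\tilde{\iota}_j : S \to S$ so defined belongs to $\mathrm{Aut}(S)$). Let $S' = \{s' \mid s \in S \}$, where $s'=s$ if $s \in S \setminus T$ and $s' = \bigcup_{j=1}^m (s^{\iota_j} \cap (X_j \times X_j))$ if $s \in T$. Then $(X,S')$ is an association scheme which is algebraically isomorphic to $(X,S)$.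
   Context: An association scheme $(X,S)$ consists of a non-empty finite set $X$ and a partition $S$ of $X\times X$ such that: (i) $1_X:=\{(x,x)\mid x\in X\}\in S$; (ii) for each $s\in S$, $s^*:=\{(x,y)\mid (y,x)\in s\}\in S$; (iii) for all $s,t,u\in S$ the number $c_{st}^u:=|xs\cap yt^*|$ is constant whenever $(x,y)\in u$, where $xs:=\{y\in X\mid (x,y)\in s\}$. The $c_{st}^u$ are the intersection numbers. For non-empty $P,Q\subseteq S$, the complex product $PQ$ is the set of all $s\in S$ such that $c_{pq}^s\neq 0$ for some $p\in P$, $q\in Q$. A non-empty subset $T\subseteq S$ is closed if $TT\subseteq T$ (equivalently, $\bigcup_{t\in T}t$ is an equivalence relation on $X$). For closed $T$, the cosets of $T$ in $X$ are the sets $xT:=\bigcup_{t\in T}xt$, $x\in X$. For a closed subset $T$ of $S$ (including $T=S$), $\mathrm{Aut}(T)=\{\iota\in\mathrm{Sym}(T)\mid c_{rs}^t=c_{r^\iota s^\iota}^{t^\iota}\text{ for all }r,s,t\in T\}$. Two association schemes $(X,S)$ and $(X_1,S_1)$ are algebraically isomorphic if there is a bijection $\iota:S\to S_1$ with $c_{rs}^t=c_{r^\iota s^\iota}^{t^\iota}$ for all $r,s,t\in S$. -}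

module Defs where

open import Data.Bool.Base using (if_then_else_)
open import Data.Fin.Base using (Fin)
open import Data.Fin.Subset using (Subset; _∈_; _∩_; ⋃; ⊥; ⁅_⁆; ∣_∣; Nonempty)
open import Data.Fin.Subset.Properties using (_∈?_)
open import Data.List.Base using (allFin; filter; map)
open import Data.Nat.Base using (ℕ; NonZero)
open import Data.Product.Base using (∃; ∃-syntax; _×_; _,_; proj₁)
open import Data.Vec.Base using (tabulate; lookup)
open import Function.Definitions using (Bijective; Injective)
open import Relation.Binary.PropositionalEquality using (_≡_; _≢_; _≗_)
open import Relation.Nullary.Decidable using (yes; no; does)

-- The underlying set X is Fin n.  A subset s of X × X is given by its
-- neighbourhoods: s x is the set xs = { y ∣ (x , y) ∈ s }.  Equality of
-- subsets of X × X is _≗_.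

BinRel : ℕ → Set
BinRel n = Fin n → Subset n

infix 4 _∈ᴿ_

_∈ᴿ_ : ∀ {n} → Fin n × Fin n → BinRel n → Set
(x , y) ∈ᴿ s = y ∈ s x

1ᴿ : ∀ {n} → BinRel n
1ᴿ x = ⁅ x ⁆

infix 9 _*ᴿ

_*ᴿ : ∀ {n} → BinRel n → BinRel n
(s *ᴿ) x = tabulate (λ y → lookup (s y) x)

infixr 7 _∩ᴿ_

_∩ᴿ_ : ∀ {n} → BinRel n → BinRel n → BinRel n
(s ∩ᴿ t) x = s x ∩ t x

infixr 8 _×ᴿ_

_×ᴿ_ : ∀ {n} → Subset n → Subset n → BinRel n
(A ×ᴿ B) x = if does (x ∈? A) then B else ⊥

⋃ᴿ : ∀ {n m} → (Fin m → BinRel n) → BinRel n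
⋃ᴿ {m = m} s x = ⋃ (map (λ j → s j x) (allFin m))

-- A finite set S of subsets of X × X is given by an enumeration
-- S : Fin d → BinRel n, and elements of S are referred to by their
-- indices.  The enumeration of a scheme has no repetitions: this follows
-- from block-nonempty and disjoint.

record IsAssociationScheme {n d : ℕ} (S : Fin d → BinRel n) : Set where
  field
    X-nonempty     : NonZero n

    block-nonempty : ∀ s → ∃[ x ] ∃[ y ] (x , y) ∈ᴿ S s
    cover          : ∀ x y → ∃[ s ] (x , y) ∈ᴿ S s
    disjoint       : ∀ {x y s t} → (x , y) ∈ᴿ S s → (x , y) ∈ᴿ S t → s ≡ t

    identity       : ∃[ s ] S s ≗ 1ᴿ
    converse       : ∀ s → ∃[ t ] S t ≗ S s *ᴿ
    regular        : ∀ s t u → ∃[ k ] ∀ {x y} → (x , y) ∈ᴿ S u →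
                     ∣ S s x ∩ (S t *ᴿ) y ∣ ≡ k

  -- c s t u is the intersection number with lower indices s, t and upper
  -- index u.  It is uniquely determined, as S u is non-empty.

  c : Fin d → Fin d → Fin d → ℕ
  c s t u = proj₁ (regular s t u)

open IsAssociationScheme using (c)

module _ {n d : ℕ} {S : Fin d → BinRel n} (isAS : IsAssociationScheme S) where

  _∈ComplexProduct[_,_] : Fin d → Subset d → Subset d → Set
  s ∈ComplexProduct[ P , Q ] =
    ∃[ p ] ∃[ q ] p ∈ P × q ∈ Q × c isAS p q s ≢ 0

  IsClosed : Subset d → Set
  IsClosed T = Nonempty T × (∀ {s} → s ∈ComplexProduct[ T , T ] → s ∈ T)

coset : ∀ {n d} → (Fin d → BinRel n) → Subset d → Fin n → Subset n
coset {d = d} S T x = ⋃ (map (λ t → S t x) (filter (_∈? T) (allFin d)))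

record AreCosets {n d m : ℕ} (S : Fin d → BinRel n) (T : Subset d)
                 (Xs : Fin m → Subset n) : Set where
  field
    distinct : Injective _≡_ _≡_ Xs
    isCoset  : ∀ j → ∃[ x ] Xs j ≡ coset S T x
    complete : ∀ x → ∃[ j ] Xs j ≡ coset S T x

IsAlgebraicIso : {A B : Set} → (A → A → A → ℕ) → (B → B → B → ℕ) →
                 (A → B) → Set
IsAlgebraicIso c₁ c₂ f =
  Bijective _≡_ _≡_ f × (∀ r s t → c₁ r s t ≡ c₂ (f r) (f s) (f t))

AlgebraicallyIsomorphic :
  ∀ {n₁ d₁ n₂ d₂} {S₁ : Fin d₁ → BinRel n₁} {S₂ : Fin d₂ → BinRel n₂} →
  IsAssociationScheme S₁ → IsAssociationScheme S₂ → Set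
AlgebraicallyIsomorphic isAS₁ isAS₂ =
  ∃[ f ] IsAlgebraicIso (c isAS₁) (c isAS₂) f

Elem : ∀ {d} → Subset d → Set
Elem T = ∃[ s ] s ∈ T

module _ {n d : ℕ} {S : Fin d → BinRel n} (isAS : IsAssociationScheme S) where

  IsAut : (Fin d → Fin d) → Set
  IsAut = IsAlgebraicIso (c isAS) (c isAS)

  IsAutOn : (T : Subset d) → (Elem T → Elem T) → Set
  IsAutOn T = IsAlgebraicIso c↾T c↾T
    where
    c↾T : Elem T → Elem T → Elem T → ℕ
    c↾T (r , _) (s , _) (t , _) = c isAS r s t

-- The map ι̃ : S → S.

extend : ∀ {d} (T : Subset d) → (Elem T → Elem T) → Fin d → Fin d
extend T ι s with s ∈? T
... | yes s∈T = proj₁ (ι (s , s∈T))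
... | no  _   = s

-- The family s ↦ s′.

twist : ∀ {n d m} → (Fin d → BinRel n) → (T : Subset d) →
        (Fin m → Subset n) → (Fin m → Elem T → Elem T) → Fin d → BinRel n
twist S T Xs ι s with s ∈? T
... | yes s∈T = ⋃ᴿ (λ j → S (proj₁ (ι j (s , s∈T))) ∩ᴿ (Xs j ×ᴿ Xs j))
... | no  _   = S s

{-# OPTIONS --safe #-}

-- Write φ j for the extension of ι j to S, and i(x) for the index of the coset
-- of x.  As φ j fixes S ∖ T and preserves T, a pair (x , y) lies in s′ if and
-- only if it lies in φ i(x) s, if and only if it lies in φ i(y) s.  Hence for
-- (x , y) ∈ u′ the number of z with (x , z) ∈ s′ and (z , y) ∈ t′ is the
-- intersection number of φ i(x) s, φ i(y) t and φ i(x) u.  It equals that of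
-- s, t, u: both automorphisms can be replaced by the same one, unless s, t ∈ T
-- and u ∉ T, when both numbers vanish.

module Submission where

open import Defs
open import Data.Fin.Base using (Fin; toℕ)
open import Data.Fin.Properties using (pigeonhole)
open import Data.Fin.Subset using (Subset; _∈_; _∉_; _⊆_; _∩_; ⋃; ∣_∣; Nonempty)
open import Data.Fin.Subset.Properties
  using (_∈?_; nonempty?; Empty-unique; ∣⊥∣≡0; ∉⊥; x∈⁅x⁆; x∈⁅y⁆⇒x≡y; ⊆-antisym;
         x∈p∩q⁺; x∈p∩q⁻; x∈p∪q⁺; x∈p∪q⁻; x∈p⇒∣p-x∣<∣p∣)
open import Data.List.Base using (List; []; _∷_; allFin; filter; map)
open import Data.List.Membership.Propositional using (find; lose)
open import Data.List.Membership.Propositional.Properties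
  using (∈-allFin; ∈-filter⁺; ∈-filter⁻)
open import Data.List.Relation.Unary.Any using (Any; here; there)
open import Data.List.Relation.Unary.Any.Properties using (map⁺; map⁻)
open import Data.Nat.Base using (ℕ; zero; suc; _<_)
open import Data.Nat.Properties using (_≟_; m<n⇒n≢0; m<1+n⇒m<n∨m≡n; n<1+n)
open import Data.Product.Base using (∃-syntax; Σ-syntax; _×_; _,_; proj₁; proj₂)
open import Data.Sum.Base using (inj₁; inj₂)
open import Data.Vec.Properties using ([]=⇒lookup; lookup⇒[]=; lookup∘tabulate)
open import Function.Base using (case_of_; id)
open import Relation.Binary.PropositionalEquality
  using (_≡_; _≢_; _≗_; refl; sym; trans; cong; cong₂; subst; module ≡-Reasoning)
open import Relation.Nullary.Decidable using (yes; no; decidable-stable)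
open import Relation.Nullary.Negation using (contradiction)

-- Membership in finite subsets, relations and cosets.

module _ {n : ℕ} where

  ∣p∣≢0⇒Nonempty : {p : Subset n} → ∣ p ∣ ≢ 0 → Nonempty p
  ∣p∣≢0⇒Nonempty {p} ∣p∣≢0 with nonempty? p
  ... | yes ne    = ne
  ... | no  empty =
    contradiction (trans (cong ∣_∣ (Empty-unique empty)) (∣⊥∣≡0 n)) ∣p∣≢0

  x∈p⇒∣p∣≢0 : {p : Subset n} {x : Fin n} → x ∈ p → ∣ p ∣ ≢ 0
  x∈p⇒∣p∣≢0 x∈p = m<n⇒n≢0 (x∈p⇒∣p-x∣<∣p∣ x∈p)

  x∈⋃⁺ : {x : Fin n} {ps : List (Subset n)} → Any (x ∈_) ps → x ∈ ⋃ ps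
  x∈⋃⁺ (here x∈p)   = x∈p∪q⁺ (inj₁ x∈p)
  x∈⋃⁺ (there x∈ps) = x∈p∪q⁺ (inj₂ (x∈⋃⁺ x∈ps))

  x∈⋃⁻ : {x : Fin n} (ps : List (Subset n)) → x ∈ ⋃ ps → Any (x ∈_) ps
  x∈⋃⁻ []       x∈ = contradiction x∈ ∉⊥
  x∈⋃⁻ (p ∷ ps) x∈ with x∈p∪q⁻ p (⋃ ps) x∈
  ... | inj₁ x∈p  = here x∈p
  ... | inj₂ x∈ps = there (x∈⋃⁻ ps x∈ps)

  ∈-*ᴿ⁺ : ∀ (s : BinRel n) {x y} → (y , x) ∈ᴿ s → (x , y) ∈ᴿ s *ᴿ
  ∈-*ᴿ⁺ s {x} {y} p =
    lookup⇒[]= y _ (trans (lookup∘tabulate _ y) ([]=⇒lookup p))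

  ∈-*ᴿ⁻ : ∀ (s : BinRel n) {x y} → (x , y) ∈ᴿ s *ᴿ → (y , x) ∈ᴿ s
  ∈-*ᴿ⁻ s {x} {y} p =
    lookup⇒[]= x _ (trans (sym (lookup∘tabulate _ y)) ([]=⇒lookup p))

  ∈-×ᴿ⁺ : ∀ {A B : Subset n} {x y} → x ∈ A → y ∈ B → (x , y) ∈ᴿ A ×ᴿ B
  ∈-×ᴿ⁺ {A} {x = x} x∈A y∈B with x ∈? A
  ... | yes _   = y∈B
  ... | no  x∉A = contradiction x∈A x∉A

  ∈-×ᴿ⁻ : ∀ (A B : Subset n) {x y} → (x , y) ∈ᴿ A ×ᴿ B → x ∈ A × y ∈ B
  ∈-×ᴿ⁻ A B {x} p with x ∈? A
  ... | yes x∈A = x∈A , p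
  ... | no  _   = contradiction p ∉⊥

  ∈-⋃ᴿ⁺ : ∀ {m} (s : Fin m → BinRel n) {x y} j → (x , y) ∈ᴿ s j → (x , y) ∈ᴿ ⋃ᴿ s
  ∈-⋃ᴿ⁺ s j p = x∈⋃⁺ (map⁺ (lose (∈-allFin j) p))

  ∈-⋃ᴿ⁻ : ∀ {m} (s : Fin m → BinRel n) {x y} → (x , y) ∈ᴿ ⋃ᴿ s →
          ∃[ j ] (x , y) ∈ᴿ s j
  ∈-⋃ᴿ⁻ s {x} p with find (map⁻ (x∈⋃⁻ (map (λ j → s j x) (allFin _)) p))
  ... | j , _ , q = j , q

  module _ {d : ℕ} (S : Fin d → BinRel n) (T : Subset d) where

    ∈-coset⁺ : ∀ {t x y} → t ∈ T → (x , y) ∈ᴿ S t → y ∈ coset S T x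
    ∈-coset⁺ t∈T p = x∈⋃⁺ (map⁺ (lose (∈-filter⁺ (_∈? T) (∈-allFin _) t∈T) p))

    ∈-coset⁻ : ∀ {x y} → y ∈ coset S T x → ∃[ t ] t ∈ T × (x , y) ∈ᴿ S t
    ∈-coset⁻ {x} y∈ with find (map⁻ (x∈⋃⁻ (map (λ t → S t x) (filter (_∈? T) (allFin d))) y∈))
    ... | t , t∈filter , p = t , proj₂ (∈-filter⁻ (_∈? T) {xs = allFin d} t∈filter) , p

-- Paths, converses and automorphisms in a scheme.

module Scheme {n d : ℕ} {S : Fin d → BinRel n} (isAS : IsAssociationScheme S) where

  open IsAssociationScheme isAS

  -- By regularity a nonzero number yields a path over every pair of `u`, while by `path⇒c≢0` a
  -- single path makes it nonzero. Together they carry configurations along automorphisms.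
  c≢0⇒path : ∀ {s t u x y} → c s t u ≢ 0 → (x , y) ∈ᴿ S u →
             ∃[ z ] (x , z) ∈ᴿ S s × (z , y) ∈ᴿ S t
  c≢0⇒path {s} {t} {u} {x} {y} c≢0 xy
    with ∣p∣≢0⇒Nonempty (λ eq → c≢0 (trans (sym (proj₂ (regular s t u) xy)) eq))
  ... | z , z∈ with x∈p∩q⁻ (S s x) ((S t *ᴿ) y) z∈
  ... | xz , zy = z , xz , ∈-*ᴿ⁻ (S t) zy

  path⇒c≢0 : ∀ {s t u x y z} → (x , z) ∈ᴿ S s → (z , y) ∈ᴿ S t → (x , y) ∈ᴿ S u →
             c s t u ≢ 0
  path⇒c≢0 {s} {t} {u} xz zy xy eq =
    x∈p⇒∣p∣≢0 (x∈p∩q⁺ (xz , ∈-*ᴿ⁺ (S t) zy)) (trans (proj₂ (regular s t u) xy) eq)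

  e : Fin d
  e = proj₁ identity

  ∈-e : ∀ x → (x , x) ∈ᴿ S e
  ∈-e x = subst (x ∈_) (sym (proj₂ identity x)) (x∈⁅x⁆ x)

  ∈-e⇒≡ : ∀ {x y} → (x , y) ∈ᴿ S e → y ≡ x
  ∈-e⇒≡ {x} {y} p = x∈⁅y⁆⇒x≡y x (subst (y ∈_) (proj₂ identity x) p)

  infix 9 _⋆

  _⋆ : Fin d → Fin d
  s ⋆ = proj₁ (converse s)

  ∈-⋆⁺ : ∀ {s x y} → (x , y) ∈ᴿ S s → (y , x) ∈ᴿ S (s ⋆)
  ∈-⋆⁺ {s} {x} {y} p = subst (x ∈_) (sym (proj₂ (converse s) y)) (∈-*ᴿ⁺ (S s) p)

  ∈-⋆⁻ : ∀ {s x y} → (x , y) ∈ᴿ S (s ⋆) → (y , x) ∈ᴿ S s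
  ∈-⋆⁻ {s} {x} {y} p = ∈-*ᴿ⁻ (S s) (subst (y ∈_) (proj₂ (converse s) x) p)

  c-⋆≢0 : ∀ s → c s (s ⋆) e ≢ 0
  c-⋆≢0 s with block-nonempty s
  ... | x , y , xy = path⇒c≢0 xy (∈-⋆⁺ xy) (∈-e x)

  -- The loop at `x` lies in `e` and `c s (s ⋆) e` is nonzero, so `s` leaves every point, not just
  -- the one given by `block-nonempty`.
  successor : ∀ s x → ∃[ y ] (x , y) ∈ᴿ S s
  successor s x with c≢0⇒path (c-⋆≢0 s) (∈-e x)
  ... | y , xy , _ = y , xy

  module Automorphism {φ : Fin d → Fin d} (φ-aut : IsAut isAS φ) where

    φ-injective : ∀ {s t} → φ s ≡ φ t → s ≡ t
    φ-injective = proj₁ (proj₁ φ-aut)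

    φ-surjective : ∀ t → ∃[ s ] φ s ≡ t
    φ-surjective t with proj₂ (proj₁ φ-aut) t
    ... | s , φs≡t = s , φs≡t refl

    φ-c : ∀ s t u → c s t u ≡ c (φ s) (φ t) (φ u)
    φ-c = proj₂ φ-aut

    -- Let `φ s` be `e`. As `c e s s` is nonzero, so is its image, which gives a path from `x` to
    -- `x` through `φ e` and then `e`. The second step is a loop, hence so is the first, and `φ e`
    -- meets `e`.
    φ-e : φ e ≡ e
    φ-e with φ-surjective e
    ... | s , φs≡e with block-nonempty s
    ...   | x , y , xy
            with c≢0⇒path (λ eq → path⇒c≢0 (∈-e x) xy xy (trans (φ-c e s s) eq))
                          (subst (λ t → (x , x) ∈ᴿ S t) (sym φs≡e) (∈-e x))
    ...     | z , xz , zx with ∈-e⇒≡ (subst (λ t → (z , x) ∈ᴿ S t) φs≡e zx)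
    ...       | refl = disjoint xz (∈-e z)

    -- The image of the nonzero `c s (s ⋆) e` gives a path from `x` to `z` in `φ s` and back in
    -- `φ (s ⋆)`, as `e` is fixed. The return step also lies in `φ s ⋆`.
    φ-⋆ : ∀ s → φ (s ⋆) ≡ φ s ⋆
    φ-⋆ s with block-nonempty e
    ... | x , _ with c≢0⇒path (λ eq → c-⋆≢0 s (trans (φ-c s (s ⋆) e) eq))
                              (subst (λ t → (x , x) ∈ᴿ S t) (sym φ-e) (∈-e x))
    ... | z , xz , zx = disjoint zx (∈-⋆⁺ xz)

-- Closed subsets and their cosets.

module Closed {n d : ℕ} {S : Fin d → BinRel n} (isAS : IsAssociationScheme S)
              {T : Subset d} (T-closed : IsClosed isAS T) where

  open IsAssociationScheme isAS
  open Scheme isAS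

  c-closed : ∀ {s t u} → s ∈ T → t ∈ T → c s t u ≢ 0 → u ∈ T
  c-closed s∈T t∈T c≢0 = proj₂ T-closed (_ , _ , s∈T , t∈T , c≢0)

  path-closed : ∀ {s t u x y z} → s ∈ T → t ∈ T → (x , z) ∈ᴿ S s → (z , y) ∈ᴿ S t →
                (x , y) ∈ᴿ S u → u ∈ T
  path-closed s∈T t∈T xz zy xy = c-closed s∈T t∈T (path⇒c≢0 xz zy xy)

  module _ {s : Fin d} (s∈T : s ∈ T) (x₀ : Fin n) where

    walk : ℕ → Fin n
    walk zero    = x₀
    walk (suc k) = proj₁ (successor s (walk k))

    walk-step : ∀ k → (walk k , walk (suc k)) ∈ᴿ S s
    walk-step k = proj₂ (successor s (walk k))

    -- Induction on `j`: the base case is a single step along `s`, and appending another step stays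
    -- in `T` because `T` is closed under products.
    walk-closed : ∀ {i j t} → i < j → (walk i , walk j) ∈ᴿ S t → t ∈ T
    walk-closed {i} {suc j} i<1+j p with m<1+n⇒m<n∨m≡n i<1+j
    ... | inj₂ refl = subst (_∈ T) (disjoint (walk-step i) p) s∈T
    ... | inj₁ i<j with cover (walk i) (walk j)
    ...   | u , q = path-closed (walk-closed i<j q) s∈T q (walk-step j) p

  -- An infinite walk along s ∈ T revisits a vertex, and the last step of the
  -- closed walk obtained in this way is the converse of a T-path.
  ⋆-closed : ∀ {s} → s ∈ T → s ⋆ ∈ T
  ⋆-closed {s} s∈T with block-nonempty s
  ... | x₀ , _ with pigeonhole (n<1+n n) (λ k → walk s∈T x₀ (toℕ k))
  ... | i , j , i<j , eq = back i<j eq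
    where
    w = walk s∈T x₀

    back : ∀ {i j} → i < j → w i ≡ w j → s ⋆ ∈ T
    back {i} {suc j} i<1+j eq with m<1+n⇒m<n∨m≡n i<1+j
    ... | inj₁ i<j  = walk-closed s∈T x₀ i<j
                        (subst (λ v → (v , w j) ∈ᴿ S (s ⋆)) (sym eq)
                               (∈-⋆⁺ (walk-step s∈T x₀ j)))
    -- The walk closes up after one step, so no path remains to be reversed. The loop lies in both
    -- `s` and `s ⋆`, which therefore coincide.
    ... | inj₂ refl = subst (_∈ T) (disjoint loop (∈-⋆⁺ loop)) s∈T
      where
      loop : (w i , w i) ∈ᴿ S s
      loop = subst (λ v → (w i , v) ∈ᴿ S s) (sym eq) (walk-step s∈T x₀ i)

  e-closed : e ∈ T
  e-closed with proj₁ T-closed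
  ... | s , s∈T = c-closed s∈T (⋆-closed s∈T) (c-⋆≢0 s)

  coset-⊆ : ∀ {x y t} → t ∈ T → (x , y) ∈ᴿ S t → coset S T y ⊆ coset S T x
  coset-⊆ {x} t∈T xy {z} z∈ with ∈-coset⁻ S T z∈
  ... | u , u∈T , yz with cover x z
  ... | v , xz = ∈-coset⁺ S T (path-closed t∈T u∈T xy yz xz) xz

  coset-≡ : ∀ {x y t} → t ∈ T → (x , y) ∈ᴿ S t → coset S T x ≡ coset S T y
  coset-≡ t∈T xy = ⊆-antisym (coset-⊆ (⋆-closed t∈T) (∈-⋆⁺ xy)) (coset-⊆ t∈T xy)

  module Cosets {m : ℕ} {Xs : Fin m → Subset n} (cosets : AreCosets S T Xs) where

    open AreCosets cosets

    index : Fin n → Fin m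
    index x = proj₁ (complete x)

    index-coset : ∀ x → Xs (index x) ≡ coset S T x
    index-coset x = proj₂ (complete x)

    index-≡ : ∀ {x y t} → t ∈ T → (x , y) ∈ᴿ S t → index x ≡ index y
    index-≡ {x} {y} t∈T xy =
      distinct (trans (index-coset x) (trans (coset-≡ t∈T xy) (sym (index-coset y))))

    ∈-index : ∀ x → x ∈ Xs (index x)
    ∈-index x = subst (x ∈_) (sym (index-coset x)) (∈-coset⁺ S T e-closed (∈-e x))

    -- A point of the coset of `y` has the same coset as `y`, and `distinct` identifies the indices.
    -- So only one term of the union in `twist` can contain a pair starting at `x`.
    ∈⇒≡index : ∀ {x j} → x ∈ Xs j → j ≡ index x
    ∈⇒≡index {x} {j} x∈Xj with isCoset j
    ... | y , Xj≡yT with ∈-coset⁻ S T (subst (x ∈_) Xj≡yT x∈Xj)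
    ... | t , t∈T , yx =
      distinct (trans Xj≡yT (trans (coset-≡ t∈T yx) (sym (index-coset x))))

-- Extensions of maps on `T`, and the twisted family.

extend-∈ : ∀ {d} {T : Subset d} (ι : Elem T → Elem T) {s} → s ∈ T → extend T ι s ∈ T
extend-∈ {T = T} ι {s} s∈T with s ∈? T
... | yes p   = proj₂ (ι (s , p))
... | no  s∉T = contradiction s∈T s∉T

extend-∉ : ∀ {d} {T : Subset d} (ι : Elem T → Elem T) {s} → s ∉ T → extend T ι s ≡ s
extend-∉ {T = T} ι {s} s∉T with s ∈? T
... | yes s∈T = contradiction s∈T s∉T
... | no  _   = refl

module Twist {n d m : ℕ} {S : Fin d → BinRel n} (isAS : IsAssociationScheme S)
             {T : Subset d} (T-closed : IsClosed isAS T)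
             {Xs : Fin m → Subset n} (cosets : AreCosets S T Xs)
             (ι : Fin m → Elem T → Elem T)
             (φ-aut : ∀ j → IsAut isAS (extend T (ι j))) where

  open IsAssociationScheme isAS
  open Scheme isAS
  open Closed isAS T-closed
  open Cosets cosets
  open module Aut j = Automorphism (φ-aut j)

  φ : Fin m → Fin d → Fin d
  φ j = extend T (ι j)

  S′ : Fin d → BinRel n
  S′ = twist S T Xs ι

  φ-∉ : ∀ i j {s} → s ∉ T → φ i s ≡ φ j s
  φ-∉ i j s∉T = trans (extend-∉ (ι i) s∉T) (sym (extend-∉ (ι j) s∉T))

  -- For `s` in `T` the pair joins points of one coset; otherwise every `φ` fixes `s`. The free `j`
  -- allows the hypothesis to refer to either endpoint.
  φ-index : ∀ j s {x y} → (x , y) ∈ᴿ S (φ j s) → φ (index x) s ≡ φ (index y) s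
  φ-index j s {x} {y} xy = case (s ∈? T) of λ where
    (yes s∈T) → cong (λ i → φ i s) (index-≡ (extend-∈ (ι j) s∈T) xy)
    (no  s∉T) → φ-∉ (index x) (index y) s∉T

  block : ∀ {s} → s ∈ T → Fin m → BinRel n
  block {s} s∈T j = S (proj₁ (ι j (s , s∈T))) ∩ᴿ (Xs j ×ᴿ Xs j)

  -- For `s` in `T` its images relate only points of a common coset, so the restriction to the
  -- square of `Xs (index x)` loses no pair starting at `x`.
  ∈-S′⁺ : ∀ s {x y} → (x , y) ∈ᴿ S (φ (index x) s) → (x , y) ∈ᴿ S′ s
  ∈-S′⁺ s {x} {y} xy with s ∈? T
  ... | no  _   = xy
  ... | yes s∈T =
    ∈-⋃ᴿ⁺ (block s∈T) (index x) (x∈p∩q⁺ (xy , ∈-×ᴿ⁺ (∈-index x) y∈Xs))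
    where
    y∈Xs : y ∈ Xs (index x)
    y∈Xs = subst (λ j → y ∈ Xs j)
                 (sym (index-≡ (proj₂ (ι (index x) (s , s∈T))) xy)) (∈-index y)

  ∈-S′⁻ : ∀ s {x y} → (x , y) ∈ᴿ S′ s → (x , y) ∈ᴿ S (φ (index x) s)
  ∈-S′⁻ s {x} {y} xy with s ∈? T
  ... | no  _   = xy
  ... | yes s∈T with ∈-⋃ᴿ⁻ (block s∈T) xy
  ...   | j , p with x∈p∩q⁻ (S (proj₁ (ι j (s , s∈T))) x) ((Xs j ×ᴿ Xs j) x) p
  ...     | q , r with ∈⇒≡index {x} (proj₁ (∈-×ᴿ⁻ (Xs j) (Xs j) r))
  ...       | refl = q

  S′-row : ∀ s x → S′ s x ≡ S (φ (index x) s) x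
  S′-row s x = ⊆-antisym (∈-S′⁻ s) (∈-S′⁺ s)

  -- Membership in `S′ s` is read off at the first endpoint, but a column fixes the second;
  -- `φ-index` passes from one to the other.
  S′-column : ∀ s y → (S′ s *ᴿ) y ≡ (S (φ (index y) s) *ᴿ) y
  S′-column s y = ⊆-antisym
    (λ {x} p → let xy = ∈-S′⁻ s (∈-*ᴿ⁻ (S′ s) p) in
      ∈-*ᴿ⁺ (S _) (subst (λ t → (x , y) ∈ᴿ S t) (φ-index (index x) s xy) xy))
    (λ {x} p → let xy = ∈-*ᴿ⁻ (S _) p in
      ∈-*ᴿ⁺ (S′ s)
        (∈-S′⁺ s (subst (λ t → (x , y) ∈ᴿ S t) (sym (φ-index (index y) s xy)) xy)))

  c-φ : ∀ s t u {x y} → (x , y) ∈ᴿ S (φ (index x) u) →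
        c (φ (index x) s) (φ (index y) t) (φ (index x) u) ≡ c s t u
  c-φ s t u {x} {y} xy = case ((u ∈? T) , (s ∈? T) , (t ∈? T)) of λ where
      -- Here `x` and `y` share a coset, so `i` and `j` agree.
      (yes u∈T , _ , _) →
        trans (cong (λ k → c (φ i s) (φ k t) (φ i u))
                    (sym (index-≡ (extend-∈ (ι i) u∈T) xy)))
              (sym (φ-c i s t u))
      -- Both `s` and `u` are fixed by every `φ`, so `φ j` serves throughout.
      (no u∉T , no s∉T , _) →
        trans (cong₂ (λ s′ u′ → c s′ (φ j t) u′) (φ-∉ i j s∉T) (φ-∉ i j u∉T))
              (sym (φ-c j s t u))
      -- Now `t` is fixed by every `φ`, so `φ i` serves throughout.
      (no _ , yes _ , no t∉T) →
        trans (cong (λ t′ → c (φ i s) t′ (φ i u)) (φ-∉ j i t∉T)) (sym (φ-c i s t u))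
      -- The two automorphisms may really differ here, but membership in `T` is preserved and
      -- closedness makes both numbers zero.
      (no u∉T , yes s∈T , yes t∈T) →
        trans (c≡0 (extend-∈ (ι i) s∈T) (extend-∈ (ι j) t∈T)
                   (subst (_∉ T) (sym (extend-∉ (ι i) u∉T)) u∉T))
              (sym (c≡0 s∈T t∈T u∉T))
    where
    i = index x
    j = index y

    c≡0 : ∀ {s t u} → s ∈ T → t ∈ T → u ∉ T → c s t u ≡ 0
    c≡0 s∈T t∈T u∉T =
      decidable-stable (_ ≟ 0) (λ c≢0 → u∉T (c-closed s∈T t∈T c≢0))

  isAS′ : IsAssociationScheme S′
  isAS′ = record
    { X-nonempty     = X-nonempty
    ; block-nonempty = block-nonempty′
    ; cover          = cover′
    -- Both memberships are read through the same `φ (index x)`, which is injective.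
    ; disjoint       = λ {x} {y} {s} {t} p q →
                         φ-injective (index x) (disjoint (∈-S′⁻ s p) (∈-S′⁻ t q))
    ; identity       = e , λ x → trans (S′-row e x)
                         (trans (cong (λ s → S s x) (φ-e (index x))) (proj₂ identity x))
    ; converse       = λ s → s ⋆ , converse′ s
    -- The old number itself is the witness, so the intersection numbers of the two schemes agree by
    -- definition.
    ; regular        = λ s t u → c s t u , λ {x} {y} → regular′ s t u
    }
    where
    block-nonempty′ : ∀ s → ∃[ x ] ∃[ y ] (x , y) ∈ᴿ S′ s
    block-nonempty′ s with block-nonempty s
    -- A point `x` is chosen first, since it decides which image of `s` has to leave it.
    ... | x , _ with successor (φ (index x) s) x
    ... | y , xy = x , y , ∈-S′⁺ s xy

    cover′ : ∀ x y → ∃[ s ] (x , y) ∈ᴿ S′ s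
    cover′ x y with cover x y
    ... | t , xy with φ-surjective (index x) t
    ... | s , refl = s , ∈-S′⁺ s xy

    converse′ : ∀ s → S′ (s ⋆) ≗ S′ s *ᴿ
    converse′ s x = begin
      S′ (s ⋆) x                 ≡⟨ S′-row (s ⋆) x ⟩
      S (φ (index x) (s ⋆)) x    ≡⟨ cong (λ t → S t x) (φ-⋆ (index x) s) ⟩
      S (φ (index x) s ⋆) x      ≡⟨ proj₂ (converse (φ (index x) s)) x ⟩
      (S (φ (index x) s) *ᴿ) x   ≡⟨ S′-column s x ⟨
      (S′ s *ᴿ) x                ∎
      where open ≡-Reasoning

    regular′ : ∀ s t u {x y} → (x , y) ∈ᴿ S′ u → ∣ S′ s x ∩ (S′ t *ᴿ) y ∣ ≡ c s t u
    regular′ s t u {x} {y} p = begin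
      ∣ S′ s x ∩ (S′ t *ᴿ) y ∣
        ≡⟨ cong₂ (λ A B → ∣ A ∩ B ∣) (S′-row s x) (S′-column t y) ⟩
      ∣ S (φ (index x) s) x ∩ (S (φ (index y) t) *ᴿ) y ∣
        ≡⟨ proj₂ (regular _ _ _) xy ⟩
      c (φ (index x) s) (φ (index y) t) (φ (index x) u)
        ≡⟨ c-φ s t u xy ⟩
      c s t u ∎
      where
      open ≡-Reasoning
      xy = ∈-S′⁻ u p

theorem1p1 : ∀ {n d m : ℕ}
    {S : Fin d → BinRel n} (isAS : IsAssociationScheme S)
    (T : Subset d) → IsClosed isAS T →
    (Xs : Fin m → Subset n) → AreCosets S T Xs →
    (ι : Fin m → Elem T → Elem T) →
    (∀ j → IsAutOn isAS T (ι j)) →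
    (∀ j → IsAut isAS (extend T (ι j))) →
    Σ[ isAS′ ∈ IsAssociationScheme (twist S T Xs ι) ]
    AlgebraicallyIsomorphic isAS′ isAS
theorem1p1 isAS T T-closed Xs cosets ι _ φ-aut =
  -- Twisting keeps the indices, so the isomorphism from the twisted scheme is the identity on them.
  isAS′ , id , (id , λ t → t , id) , λ _ _ _ → refl
  where open Twist isAS T-closed cosets ι φ-aut
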